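{- Let $W\ge 1$ be an integer and let $0\le\epsilon\le\frac14$. Any deterministic algorithm that provides a $W\epsilon$-additive approximation for the Basic-Counting problem with window size $W$ requires at least $$\left\lfloor \max\left\{\log W,\ \frac{1}{2\epsilon+W^{ -1}}\right\}\right\rfloor$$ bits of memory.
   Context: All logarithms are base 2. Basic-Counting: given a stream of bits arriving one at a time and a window size $W$, maintain $C^W$, the number of 1's among the last $W$ bits of the stream (if fewer than $W$ bits have arrived, among all bits so far). A deterministic algorithm using $m$ bits of memory ($m$ a nonnegative integer) has at most $2^m$ memory configurations, a fixed initial configuration, and a deterministic transition of configuration upon each arriving bit; when queried it outputs a real number determined by its current configuration. It provides a $W\epsilon$-additive approximation for Basic-Counting if for every input stream and at every time the query answer $\widehat{C^W}$ satisfies $|C^W-\widehat{C^W}|\le W\epsilon$. -}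

module Defs where

open import Data.Bool using (Bool; if_then_else_)
open import Data.Fin using (Fin)
open import Data.Integer as ℤ using (ℤ; +_)
import Data.Integer.Properties as ℤ
open import Data.List using (List; []; _∷_; take; map)
open import Data.Nat as ℕ using (ℕ; zero; suc; s≤s; z≤n)
import Data.Nat.Properties as ℕ
open import Data.Nat.Induction using (<-rec)
open import Data.Nat.ListAction using (sum)
open import Data.Nat.Logarithm
open import Data.Product using (∃; _×_; _,_; proj₁; proj₂)
open import Data.Rational as ℚ using (ℚ; 0ℚ; 1ℚ; ½; mkℚ; toℚᵘ)
import Data.Rational.Properties as ℚ
open import Data.Rational.Solver using (module +-*-Solver)
import Data.Rational.Unnormalised as ℚᵘ
import Data.Rational.Unnormalised.Properties as ℚᵘ
open import Data.Sum using (inj₁; inj₂)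
open import Function.Bundles using (_↣_)
open import Relation.Binary.PropositionalEquality
open import Relation.Nullary using (contradiction)

module ℚ-Lemmas where

  infix 4 _≈[_]_

  -- Distance at most t, without the absolute value.
  _≈[_]_ : ℚ → ℚ → ℚ → Set
  p ≈[ t ] q = (p ℚ.≤ q ℚ.+ t) × (q ℚ.≤ p ℚ.+ t)

  p-q+q : ∀ p q → q ℚ.+ (p ℚ.- q) ≡ p
  p-q+q = solve 2 (λ p q → q :+ (p :- q) := p) refl
    where open +-*-Solver

  p+t-p : ∀ p t → (p ℚ.+ t) ℚ.- p ≡ t
  p+t-p = solve 2 (λ p t → (p :+ t) :- p := t) refl
    where open +-*-Solver

  -[p-q] : ∀ p q → ℚ.- (p ℚ.- q) ≡ q ℚ.- p
  -[p-q] = solve 2 (λ p q → :- (p :- q) := q :- p) refl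
    where open +-*-Solver

  p≤∣p∣ : ∀ p → p ℚ.≤ ℚ.∣ p ∣
  p≤∣p∣ p with ℚ.≤-total 0ℚ p
  ... | inj₁ 0≤p = ℚ.≤-reflexive (sym (ℚ.0≤p⇒∣p∣≡p 0≤p))
  ... | inj₂ p≤0 = ℚ.≤-trans p≤0 (ℚ.0≤∣p∣ p)

  ∣p-q∣≡∣q-p∣ : ∀ p q → ℚ.∣ p ℚ.- q ∣ ≡ ℚ.∣ q ℚ.- p ∣
  ∣p-q∣≡∣q-p∣ p q = trans (sym (ℚ.∣-p∣≡∣p∣ (p ℚ.- q))) (cong ℚ.∣_∣ (-[p-q] p q))

  ∣-∣≤⇒≤ : ∀ {p q t} → ℚ.∣ p ℚ.- q ∣ ℚ.≤ t → p ℚ.≤ q ℚ.+ t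
  ∣-∣≤⇒≤ {p} {q} {t} h = subst (ℚ._≤ q ℚ.+ t) (p-q+q p q)
    (ℚ.+-monoʳ-≤ q (ℚ.≤-trans (p≤∣p∣ (p ℚ.- q)) h))

  ∣-∣≤⇒≈ : ∀ {p q t} → ℚ.∣ p ℚ.- q ∣ ℚ.≤ t → p ≈[ t ] q
  ∣-∣≤⇒≈ {p} {q} {t} h = ∣-∣≤⇒≤ h , ∣-∣≤⇒≤ (subst (ℚ._≤ t) (∣p-q∣≡∣q-p∣ p q) h)

  ≤⇒-≤ : ∀ {p q t} → p ℚ.≤ q ℚ.+ t → p ℚ.- q ℚ.≤ t
  ≤⇒-≤ {p} {q} {t} h = subst (p ℚ.- q ℚ.≤_) (p+t-p q t) (ℚ.+-monoˡ-≤ (ℚ.- q) h)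

  ≈⇒∣-∣≤ : ∀ {p q t} → p ≈[ t ] q → ℚ.∣ p ℚ.- q ∣ ℚ.≤ t
  ≈⇒∣-∣≤ {p} {q} {t} (h₁ , h₂) with ℚ.∣p∣≡p∨∣p∣≡-p (p ℚ.- q)
  ... | inj₁ e = subst (ℚ._≤ t) (sym e) (≤⇒-≤ h₁)
  ... | inj₂ e = subst (ℚ._≤ t) (sym (trans e (-[p-q] p q))) (≤⇒-≤ h₂)

  *-pos : ∀ {p q} → 0ℚ ℚ.< p → 0ℚ ℚ.< q → 0ℚ ℚ.< p ℚ.* q
  *-pos {p} {q} 0<p 0<q =
    ℚ.positive⁻¹ (p ℚ.* q) {{ℚ.pos*pos⇒pos p {{ℚ.positive 0<p}} q {{ℚ.positive 0<q}}}}

  ½*-pos : ∀ {p} → 0ℚ ℚ.< p → 0ℚ ℚ.< ½ ℚ.* p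
  ½*-pos = *-pos (ℚ.positive⁻¹ ½)

  *-mono-≤ : ∀ {p q r s} → 0ℚ ℚ.≤ r → 0ℚ ℚ.≤ q → p ℚ.≤ q → r ℚ.≤ s → p ℚ.* r ℚ.≤ q ℚ.* s
  *-mono-≤ {p} {q} {r} {s} 0≤r 0≤q p≤q r≤s = ℚ.≤-trans
    (ℚ.*-monoʳ-≤-nonNeg r {{ℚ.nonNegative 0≤r}} p≤q)
    (ℚ.*-monoˡ-≤-nonNeg q {{ℚ.nonNegative 0≤q}} r≤s)

  ½+½ : ∀ p → ½ ℚ.* p ℚ.+ ½ ℚ.* p ≡ p
  ½+½ p = trans (sym (ℚ.*-distribʳ-+ p ½ ½)) (ℚ.*-identityˡ p)

  +-close : ∀ a b c d {u v} → ℚ.∣ a ℚ.- c ∣ ℚ.≤ u → ℚ.∣ b ℚ.- d ∣ ℚ.≤ v →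
            ℚ.∣ (a ℚ.+ b) ℚ.- (c ℚ.+ d) ∣ ℚ.≤ u ℚ.+ v
  +-close a b c d {u} {v} a-c≤u b-d≤v = begin
    ℚ.∣ (a ℚ.+ b) ℚ.- (c ℚ.+ d) ∣       ≡⟨ cong ℚ.∣_∣ (rearrange a b c d) ⟩
    ℚ.∣ (a ℚ.- c) ℚ.+ (b ℚ.- d) ∣       ≤⟨ ℚ.∣p+q∣≤∣p∣+∣q∣ (a ℚ.- c) (b ℚ.- d) ⟩
    ℚ.∣ a ℚ.- c ∣ ℚ.+ ℚ.∣ b ℚ.- d ∣     ≤⟨ ℚ.+-mono-≤ a-c≤u b-d≤v ⟩
    u ℚ.+ v                             ∎
    where
    open ℚ.≤-Reasoning
    rearrange : ∀ a b c d → (a ℚ.+ b) ℚ.- (c ℚ.+ d) ≡ (a ℚ.- c) ℚ.+ (b ℚ.- d)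
    rearrange = solve 4 (λ a b c d → (a :+ b) :- (c :+ d) := (a :- c) :+ (b :- d)) refl
      where open +-*-Solver

  *-close : ∀ a b c d {A B u v} →
            ℚ.∣ a ℚ.- c ∣ ℚ.≤ u → ℚ.∣ b ∣ ℚ.≤ B → ℚ.∣ b ℚ.- d ∣ ℚ.≤ v → ℚ.∣ c ∣ ℚ.≤ A →
            ℚ.∣ a ℚ.* b ℚ.- c ℚ.* d ∣ ℚ.≤ u ℚ.* B ℚ.+ v ℚ.* A
  *-close a b c d {A} {B} {u} {v} a-c≤u b≤B b-d≤v c≤A = begin
    ℚ.∣ a ℚ.* b ℚ.- c ℚ.* d ∣
      ≡⟨ cong ℚ.∣_∣ (rearrange a b c d) ⟩
    ℚ.∣ (a ℚ.- c) ℚ.* b ℚ.+ (b ℚ.- d) ℚ.* c ∣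
      ≤⟨ ℚ.∣p+q∣≤∣p∣+∣q∣ ((a ℚ.- c) ℚ.* b) ((b ℚ.- d) ℚ.* c) ⟩
    ℚ.∣ (a ℚ.- c) ℚ.* b ∣ ℚ.+ ℚ.∣ (b ℚ.- d) ℚ.* c ∣
      ≤⟨ ℚ.+-mono-≤ (bound (a ℚ.- c) b a-c≤u b≤B) (bound (b ℚ.- d) c b-d≤v c≤A) ⟩
    u ℚ.* B ℚ.+ v ℚ.* A ∎
    where
    open ℚ.≤-Reasoning
    rearrange : ∀ a b c d → (a ℚ.* b) ℚ.- (c ℚ.* d) ≡ (a ℚ.- c) ℚ.* b ℚ.+ (b ℚ.- d) ℚ.* c
    rearrange = solve 4 (λ a b c d → (a :* b) :- (c :* d) := (a :- c) :* b :+ (b :- d) :* c) refl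
      where open +-*-Solver
    bound : ∀ p q {s t} → ℚ.∣ p ∣ ℚ.≤ s → ℚ.∣ q ∣ ℚ.≤ t → ℚ.∣ p ℚ.* q ∣ ℚ.≤ s ℚ.* t
    bound p q {s} {t} h₁ h₂ = subst (ℚ._≤ s ℚ.* t) (sym (ℚ.∣p*q∣≡∣p∣*∣q∣ p q))
      (*-mono-≤ {ℚ.∣ p ∣} {s} {ℚ.∣ q ∣} {t} (ℚ.0≤∣p∣ q) (ℚ.≤-trans (ℚ.0≤∣p∣ p) h₁) h₁ h₂)

open ℚ-Lemmas

-- The real numbers, as Cauchy sequences of rationals.

IsCauchy : (ℕ → ℚ) → Set
IsCauchy x = ∀ δ → 0ℚ ℚ.< δ →
  ∃ λ N → ∀ i j → N ℕ.≤ i → N ℕ.≤ j → ℚ.∣ x i ℚ.- x j ∣ ℚ.≤ δ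

record ℝ : Set where
  constructor mkℝ
  field
    seq      : ℕ → ℚ
    isCauchy : IsCauchy seq

open ℝ public

infix  4 _≤_ _<_
infixl 6 _+_ _-_ _⊔_
infixl 7 _*_
infix  8 -_
infix  9 _⁻¹⟨_⟩

_≤_ : ℝ → ℝ → Set
x ≤ y = ∀ δ → 0ℚ ℚ.< δ → ∃ λ N → ∀ i → N ℕ.≤ i → seq x i ℚ.≤ seq y i ℚ.+ δ

_<_ : ℝ → ℝ → Set
x < y = ∃ λ δ → 0ℚ ℚ.< δ × ∃ λ N → ∀ i → N ℕ.≤ i → seq x i ℚ.+ δ ℚ.≤ seq y i

fromℚ : ℚ → ℝ
fromℚ q = mkℝ (λ _ → q) λ δ 0<δ → 0 , λ _ _ _ _ →
  subst (ℚ._≤ δ) (sym (cong ℚ.∣_∣ (ℚ.+-inverseʳ q))) (ℚ.<⇒≤ 0<δ)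

fromℤ : ℤ → ℝ
fromℤ k = fromℚ (k ℚ./ 1)

fromℕ : ℕ → ℝ
fromℕ n = fromℤ (+ n)

0ℝ : ℝ
0ℝ = fromℕ 0

-_ : ℝ → ℝ
- x = mkℝ (λ i → ℚ.- seq x i) λ δ 0<δ → let N , h = isCauchy x δ 0<δ in
  N , λ i j Ni Nj → subst (ℚ._≤ δ) (eq (seq x i) (seq x j)) (h i j Ni Nj)
  where
  eq : ∀ p q → ℚ.∣ p ℚ.- q ∣ ≡ ℚ.∣ ℚ.- p ℚ.- ℚ.- q ∣
  eq p q = trans (sym (ℚ.∣-p∣≡∣p∣ (p ℚ.- q))) (cong ℚ.∣_∣ (ℚ.neg-distrib-+ p (ℚ.- q)))

_+_ : ℝ → ℝ → ℝ
x + y = mkℝ (λ i → seq x i ℚ.+ seq y i) λ δ 0<δ →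
  let M , hx = isCauchy x (½ ℚ.* δ) (½*-pos 0<δ)
      N , hy = isCauchy y (½ ℚ.* δ) (½*-pos 0<δ)
  in M ℕ.⊔ N , λ i j Ki Kj →
    subst (ℚ.∣ (seq x i ℚ.+ seq y i) ℚ.- (seq x j ℚ.+ seq y j) ∣ ℚ.≤_) (½+½ δ)
      (+-close (seq x i) (seq y i) (seq x j) (seq y j)
        (hx i j (ℕ.m⊔n≤o⇒m≤o M N Ki) (ℕ.m⊔n≤o⇒m≤o M N Kj))
        (hy i j (ℕ.m⊔n≤o⇒n≤o M N Ki) (ℕ.m⊔n≤o⇒n≤o M N Kj)))

_-_ : ℝ → ℝ → ℝ
x - y = x + (- y)

_*_ : ℝ → ℝ → ℝ
x * y = mkℝ (λ i → seq x i ℚ.* seq y i) cauchy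
  where
  bounded : ∀ z → ∃ λ B → 0ℚ ℚ.< B × ∃ λ N → ∀ i → N ℕ.≤ i → ℚ.∣ seq z i ∣ ℚ.≤ B
  bounded z with isCauchy z 1ℚ (ℚ.positive⁻¹ 1ℚ)
  ... | N , h = B , 0<B , N , bound
    where
    B : ℚ
    B = 1ℚ ℚ.+ ℚ.∣ seq z N ∣
    0<B : 0ℚ ℚ.< B
    0<B = ℚ.+-mono-<-≤ (ℚ.positive⁻¹ 1ℚ) (ℚ.0≤∣p∣ (seq z N))
    bound : ∀ i → N ℕ.≤ i → ℚ.∣ seq z i ∣ ℚ.≤ B
    bound i Ni = begin
      ℚ.∣ seq z i ∣                                     ≡⟨ cong ℚ.∣_∣ (trans (sym (p-q+q _ (seq z N))) (ℚ.+-comm (seq z N) _)) ⟩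
      ℚ.∣ (seq z i ℚ.- seq z N) ℚ.+ seq z N ∣           ≤⟨ ℚ.∣p+q∣≤∣p∣+∣q∣ (seq z i ℚ.- seq z N) (seq z N) ⟩
      ℚ.∣ seq z i ℚ.- seq z N ∣ ℚ.+ ℚ.∣ seq z N ∣       ≤⟨ ℚ.+-monoˡ-≤ ℚ.∣ seq z N ∣ (h i N Ni ℕ.≤-refl) ⟩
      B                                                 ∎
      where open ℚ.≤-Reasoning
  -- The tolerance allowed on one factor when the other is bounded by C.
  tol : ∀ δ C → 0ℚ ℚ.< C → ℚ
  tol δ C 0<C = (½ ℚ.* δ) ℚ.* (ℚ.1/ C) {{ℚ.>-nonZero 0<C}}
  tol-pos : ∀ {δ} C (0<C : 0ℚ ℚ.< C) → 0ℚ ℚ.< δ → 0ℚ ℚ.< tol δ C 0<C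
  tol-pos C 0<C 0<δ = *-pos (½*-pos 0<δ)
    (ℚ.positive⁻¹ _ {{ℚ.1/pos⇒pos C {{ℚ.positive 0<C}}}})
  tol-cancel : ∀ δ C (0<C : 0ℚ ℚ.< C) → tol δ C 0<C ℚ.* C ≡ ½ ℚ.* δ
  tol-cancel δ C 0<C = trans (ℚ.*-assoc (½ ℚ.* δ) _ C)
    (trans (cong (½ ℚ.* δ ℚ.*_) (ℚ.*-inverseˡ C {{ℚ.>-nonZero 0<C}}))
           (ℚ.*-identityʳ (½ ℚ.* δ)))
  tols : ∀ δ A B (0<A : 0ℚ ℚ.< A) (0<B : 0ℚ ℚ.< B) →
         tol δ B 0<B ℚ.* B ℚ.+ tol δ A 0<A ℚ.* A ≡ δ
  tols δ A B 0<A 0<B = trans (cong₂ ℚ._+_ (tol-cancel δ B 0<B) (tol-cancel δ A 0<A)) (½+½ δ)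
  cauchy : IsCauchy (λ i → seq x i ℚ.* seq y i)
  cauchy δ 0<δ =
    let A , 0<A , K , hA = bounded x
        B , 0<B , L , hB = bounded y
        M , hx = isCauchy x (tol δ B 0<B) (tol-pos B 0<B 0<δ)
        N , hy = isCauchy y (tol δ A 0<A) (tol-pos A 0<A 0<δ)
    in (K ℕ.⊔ L) ℕ.⊔ (M ℕ.⊔ N) , λ i j Pi Pj →
      let KLi = ℕ.m⊔n≤o⇒m≤o (K ℕ.⊔ L) (M ℕ.⊔ N) Pi
          KLj = ℕ.m⊔n≤o⇒m≤o (K ℕ.⊔ L) (M ℕ.⊔ N) Pj
          MNi = ℕ.m⊔n≤o⇒n≤o (K ℕ.⊔ L) (M ℕ.⊔ N) Pi
          MNj = ℕ.m⊔n≤o⇒n≤o (K ℕ.⊔ L) (M ℕ.⊔ N) Pj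
      in subst (ℚ.∣ seq x i ℚ.* seq y i ℚ.- seq x j ℚ.* seq y j ∣ ℚ.≤_)
        (tols δ A B 0<A 0<B)
        (*-close (seq x i) (seq y i) (seq x j) (seq y j)
          (hx i j (ℕ.m⊔n≤o⇒m≤o M N MNi) (ℕ.m⊔n≤o⇒m≤o M N MNj))
          (hB i (ℕ.m⊔n≤o⇒n≤o K L KLi))
          (hy i j (ℕ.m⊔n≤o⇒n≤o M N MNi) (ℕ.m⊔n≤o⇒n≤o M N MNj))
          (hA j (ℕ.m⊔n≤o⇒m≤o K L KLj)))

_⊔_ : ℝ → ℝ → ℝ
x ⊔ y = mkℝ (λ i → seq x i ℚ.⊔ seq y i) cauchy
  where
  half : ∀ a b c d {t} → a ℚ.≤ c ℚ.+ t → b ℚ.≤ d ℚ.+ t → a ℚ.⊔ b ℚ.≤ (c ℚ.⊔ d) ℚ.+ t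
  half a b c d {t} h₁ h₂ = ℚ.⊔-lub
    (ℚ.≤-trans h₁ (ℚ.+-monoˡ-≤ t (ℚ.p≤p⊔q c d)))
    (ℚ.≤-trans h₂ (ℚ.+-monoˡ-≤ t (ℚ.p≤q⊔p c d)))
  cauchy : IsCauchy (λ i → seq x i ℚ.⊔ seq y i)
  cauchy δ 0<δ =
    let M , hx = isCauchy x δ 0<δ
        N , hy = isCauchy y δ 0<δ
    in M ℕ.⊔ N , λ i j Ki Kj →
      let ax , bx = ∣-∣≤⇒≈ (hx i j (ℕ.m⊔n≤o⇒m≤o M N Ki) (ℕ.m⊔n≤o⇒m≤o M N Kj))
          ay , by = ∣-∣≤⇒≈ (hy i j (ℕ.m⊔n≤o⇒n≤o M N Ki) (ℕ.m⊔n≤o⇒n≤o M N Kj))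
      in ≈⇒∣-∣≤ (half (seq x i) (seq y i) (seq x j) (seq y j) ax ay ,
                half (seq x j) (seq y j) (seq x i) (seq y i) bx by)

∣_∣ : ℝ → ℝ
∣ x ∣ = x ⊔ - x

-- Since x is eventually at least c > 0, the terms c ⊔ seq x i eventually
-- agree with seq x i; the maximum only keeps every term invertible.
_⁻¹⟨_⟩ : (x : ℝ) → 0ℝ < x → ℝ
x ⁻¹⟨ c , 0<c , _ ⟩ = mkℝ inv cauchy
  where
  y : ℕ → ℚ
  y i = c ℚ.⊔ seq x i
  c≤y : ∀ i → c ℚ.≤ y i
  c≤y i = ℚ.p≤p⊔q c (seq x i)
  0<y : ∀ i → 0ℚ ℚ.< y i
  0<y i = ℚ.<-≤-trans 0<c (c≤y i)
  inv : ℕ → ℚ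
  inv i = (ℚ.1/ y i) {{ℚ.>-nonZero (0<y i)}}
  half : ∀ p q {t} → 0ℚ ℚ.≤ t → p ℚ.≤ q ℚ.+ t → c ℚ.⊔ p ℚ.≤ (c ℚ.⊔ q) ℚ.+ t
  half p q {t} 0≤t h = ℚ.⊔-lub
    (subst (ℚ._≤ (c ℚ.⊔ q) ℚ.+ t) (ℚ.+-identityʳ c) (ℚ.+-mono-≤ (ℚ.p≤p⊔q c q) 0≤t))
    (ℚ.≤-trans h (ℚ.+-monoˡ-≤ t (ℚ.p≤q⊔p c q)))
  expand : ∀ a b r s → (r ℚ.- s) ℚ.* (a ℚ.* b) ≡ (r ℚ.* a) ℚ.* b ℚ.- (s ℚ.* b) ℚ.* a
  expand = solve 4 (λ a b r s → (r :- s) :* (a :* b) := (r :* a) :* b :- (s :* b) :* a) refl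
    where open +-*-Solver
  difference : ∀ i j → (inv i ℚ.- inv j) ℚ.* (y i ℚ.* y j) ≡ y j ℚ.- y i
  difference i j = trans (expand (y i) (y j) (inv i) (inv j)) (cong₂ ℚ._-_
    (trans (cong (ℚ._* y j) (ℚ.*-inverseˡ (y i) {{ℚ.>-nonZero (0<y i)}})) (ℚ.*-identityˡ (y j)))
    (trans (cong (ℚ._* y i) (ℚ.*-inverseˡ (y j) {{ℚ.>-nonZero (0<y j)}})) (ℚ.*-identityˡ (y i))))
  0<cc : 0ℚ ℚ.< c ℚ.* c
  0<cc = *-pos 0<c 0<c
  cauchy : IsCauchy inv
  cauchy δ 0<δ = let N , h = isCauchy x (δ ℚ.* (c ℚ.* c)) (*-pos 0<δ 0<cc) in
    N , λ i j Ni Nj →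
    let open ℚ.≤-Reasoning
        u = inv i ℚ.- inv j
        0≤t = ℚ.<⇒≤ (*-pos 0<δ 0<cc)
        g₁ , g₂ = ∣-∣≤⇒≈ (h i j Ni Nj)
    in ℚ.*-cancelʳ-≤-pos (c ℚ.* c) {{ℚ.positive 0<cc}} (begin
      ℚ.∣ u ∣ ℚ.* (c ℚ.* c)
        ≤⟨ ℚ.*-monoˡ-≤-nonNeg ℚ.∣ u ∣ {{ℚ.∣-∣-nonNeg u}}
             (*-mono-≤ (ℚ.<⇒≤ 0<c) (ℚ.<⇒≤ (0<y i)) (c≤y i) (c≤y j)) ⟩
      ℚ.∣ u ∣ ℚ.* (y i ℚ.* y j)
        ≡⟨ cong (ℚ.∣ u ∣ ℚ.*_) (sym (ℚ.0≤p⇒∣p∣≡p (ℚ.<⇒≤ (*-pos (0<y i) (0<y j))))) ⟩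
      ℚ.∣ u ∣ ℚ.* ℚ.∣ y i ℚ.* y j ∣
        ≡⟨ sym (ℚ.∣p*q∣≡∣p∣*∣q∣ u (y i ℚ.* y j)) ⟩
      ℚ.∣ u ℚ.* (y i ℚ.* y j) ∣
        ≡⟨ cong ℚ.∣_∣ (difference i j) ⟩
      ℚ.∣ y j ℚ.- y i ∣
        ≤⟨ ≈⇒∣-∣≤ (half (seq x j) (seq x i) 0≤t g₂ , half (seq x i) (seq x j) 0≤t g₁) ⟩
      δ ℚ.* (c ℚ.* c) ∎)

2x+1/n-positive : ∀ x n .{{_ : ℕ.NonZero n}} → 0ℝ ≤ x → 0ℝ < fromℕ 2 * x + fromℚ (+ 1 ℚ./ n)
2x+1/n-positive x n 0≤x = ½ ℚ.* c , ½*-pos 0<c , N , λ i Ni →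
    subst₂ ℚ._≤_ (left c) (right (seq x i) c)
      (ℚ.+-monoˡ-≤ (½ ℚ.* c) (ℚ.*-monoˡ-≤-nonNeg (+ 2 ℚ./ 1) (h i Ni)))
  where
  c : ℚ
  c = + 1 ℚ./ n
  0<c : 0ℚ ℚ.< c
  0<c = ℚ.positive⁻¹ c {{ℚ.normalize-pos 1 n}}
  N = proj₁ (0≤x (½ ℚ.* (½ ℚ.* c)) (½*-pos (½*-pos 0<c)))
  h = proj₂ (0≤x (½ ℚ.* (½ ℚ.* c)) (½*-pos (½*-pos 0<c)))
  left : ∀ c → (+ 2 ℚ./ 1) ℚ.* 0ℚ ℚ.+ ½ ℚ.* c ≡ 0ℚ ℚ.+ ½ ℚ.* c
  left c = cong (ℚ._+ ½ ℚ.* c) (ℚ.*-zeroʳ (+ 2 ℚ./ 1))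
  right : ∀ p c → (+ 2 ℚ./ 1) ℚ.* (p ℚ.+ ½ ℚ.* (½ ℚ.* c)) ℚ.+ ½ ℚ.* c ≡ (+ 2 ℚ./ 1) ℚ.* p ℚ.+ c
  right = solve 2 (λ p c →
    con (+ 2 ℚ./ 1) :* (p :+ con ½ :* (con ½ :* c)) :+ con ½ :* c := con (+ 2 ℚ./ 1) :* p :+ c) refl
    where open +-*-Solver

module Log₂-Lemmas where

  2^⌊log₂n⌋≤n : ∀ n .{{_ : ℕ.NonZero n}} → 2 ℕ.^ ⌊log₂ n ⌋ ℕ.≤ n
  2^⌊log₂n⌋≤n = <-rec _ go
    where
    go : ∀ n → (∀ {m} → m ℕ.< n → .{{_ : ℕ.NonZero m}} → 2 ℕ.^ ⌊log₂ m ⌋ ℕ.≤ m) →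
         .{{_ : ℕ.NonZero n}} → 2 ℕ.^ ⌊log₂ n ⌋ ℕ.≤ n
    go 1 rec = s≤s z≤n
    go n@(suc (suc k)) rec = begin
      2 ℕ.^ ⌊log₂ n ⌋                  ≡⟨ cong (2 ℕ.^_) (ℕ.m∸n+n≡m 1≤log) ⟨
      2 ℕ.^ (⌊log₂ n ⌋ ℕ.∸ 1 ℕ.+ 1)    ≡⟨ cong (2 ℕ.^_) (ℕ.+-comm (⌊log₂ n ⌋ ℕ.∸ 1) 1) ⟩
      2 ℕ.* 2 ℕ.^ (⌊log₂ n ⌋ ℕ.∸ 1)    ≡⟨ cong (λ e → 2 ℕ.* 2 ℕ.^ e) (⌊log₂⌊n/2⌋⌋≡⌊log₂n⌋∸1 n) ⟨
      2 ℕ.* 2 ℕ.^ ⌊log₂ ℕ.⌊ n /2⌋ ⌋    ≤⟨ ℕ.*-monoʳ-≤ 2 (rec (ℕ.⌊n/2⌋<n (suc k))) ⟩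
      2 ℕ.* ℕ.⌊ n /2⌋                  ≡⟨ cong (ℕ.⌊ n /2⌋ ℕ.+_) (ℕ.+-identityʳ ℕ.⌊ n /2⌋) ⟩
      ℕ.⌊ n /2⌋ ℕ.+ ℕ.⌊ n /2⌋          ≤⟨ ℕ.+-monoʳ-≤ ℕ.⌊ n /2⌋ (ℕ.⌊n/2⌋≤⌈n/2⌉ n) ⟩
      ℕ.⌊ n /2⌋ ℕ.+ ℕ.⌈ n /2⌉          ≡⟨ ℕ.⌊n/2⌋+⌈n/2⌉≡n n ⟩
      n                                ∎
      where
      open ℕ.≤-Reasoning
      1≤log : 1 ℕ.≤ ⌊log₂ n ⌋
      1≤log = ⌊log₂⌋-mono-≤ {2} {n} (s≤s (s≤s z≤n))

  n<2^1+⌊log₂n⌋ : ∀ n → n ℕ.< 2 ℕ.^ suc ⌊log₂ n ⌋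
  n<2^1+⌊log₂n⌋ n = ℕ.≰⇒> λ 2^≤n → ℕ.n≮n ⌊log₂ n ⌋
    (subst (ℕ._≤ ⌊log₂ n ⌋) (⌊log₂[2^n]⌋≡n (suc ⌊log₂ n ⌋)) (⌊log₂⌋-mono-≤ 2^≤n))

  ^-cancel-< : ∀ {a b} → 2 ℕ.^ a ℕ.< 2 ℕ.^ b → a ℕ.< b
  ^-cancel-< {a} {b} h = ℕ.≰⇒> λ b≤a → ℕ.<⇒≱ h (ℕ.^-monoʳ-≤ 2 b≤a)

  log-cross : ∀ W .{{_ : ℕ.NonZero W}} i j →
              ⌊log₂ W ℕ.^ suc i ⌋ ℕ.* suc j ℕ.< suc ⌊log₂ W ℕ.^ suc j ⌋ ℕ.* suc i
  log-cross W i j = ^-cancel-< (begin-strict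
    2 ℕ.^ (a ℕ.* suc j)           ≡⟨ ℕ.^-*-assoc 2 a (suc j) ⟨
    (2 ℕ.^ a) ℕ.^ suc j           ≤⟨ ℕ.^-monoˡ-≤ (suc j) (2^⌊log₂n⌋≤n (W ℕ.^ suc i) {{ℕ.m^n≢0 W (suc i)}}) ⟩
    (W ℕ.^ suc i) ℕ.^ suc j       ≡⟨ ℕ.^-*-assoc W (suc i) (suc j) ⟩
    W ℕ.^ (suc i ℕ.* suc j)       ≡⟨ cong (W ℕ.^_) (ℕ.*-comm (suc i) (suc j)) ⟩
    W ℕ.^ (suc j ℕ.* suc i)       ≡⟨ ℕ.^-*-assoc W (suc j) (suc i) ⟨
    (W ℕ.^ suc j) ℕ.^ suc i       <⟨ ℕ.^-monoˡ-< (suc i) (n<2^1+⌊log₂n⌋ (W ℕ.^ suc j)) ⟩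
    (2 ℕ.^ suc b) ℕ.^ suc i       ≡⟨ ℕ.^-*-assoc 2 (suc b) (suc i) ⟩
    2 ℕ.^ (suc b ℕ.* suc i)       ∎)
    where
    open ℕ.≤-Reasoning
    a = ⌊log₂ W ℕ.^ suc i ⌋
    b = ⌊log₂ W ℕ.^ suc j ⌋

  /-mono-≤ : ∀ a b i j → a ℕ.* suc j ℕ.≤ b ℕ.* suc i → + a ℚ./ suc i ℚ.≤ + b ℚ./ suc j
  /-mono-≤ a b i j h = ℚ.toℚᵘ-cancel-≤
    (ℚᵘ.≤-respˡ-≃ (ℚᵘ.≃-sym (ℚ.toℚᵘ-fromℚᵘ (ℚᵘ.mkℚᵘ (+ a) i)))
    (ℚᵘ.≤-respʳ-≃ (ℚᵘ.≃-sym (ℚ.toℚᵘ-fromℚᵘ (ℚᵘ.mkℚᵘ (+ b) j)))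
    (ℚᵘ.*≤* (subst₂ ℤ._≤_ (ℤ.pos-* a (suc j)) (ℤ.pos-* b (suc i)) (ℤ.+≤+ h)))))

  suc-/ : ∀ b j → + suc b ℚ./ suc j ≡ + b ℚ./ suc j ℚ.+ + 1 ℚ./ suc j
  suc-/ b j = ℚ.toℚᵘ-injective (begin
    toℚᵘ (+ suc b ℚ./ suc j)
      ≈⟨ ℚ.toℚᵘ-fromℚᵘ (ℚᵘ.mkℚᵘ (+ suc b) j) ⟩
    ℚᵘ.mkℚᵘ (+ suc b) j
      ≈⟨ ℚᵘ.*≡* cross ⟩
    ℚᵘ.mkℚᵘ (+ b) j ℚᵘ.+ ℚᵘ.mkℚᵘ (+ 1) j
      ≈⟨ ℚᵘ.+-cong (ℚ.toℚᵘ-fromℚᵘ (ℚᵘ.mkℚᵘ (+ b) j)) (ℚ.toℚᵘ-fromℚᵘ (ℚᵘ.mkℚᵘ (+ 1) j)) ⟨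
    toℚᵘ (+ b ℚ./ suc j) ℚᵘ.+ toℚᵘ (+ 1 ℚ./ suc j)
      ≈⟨ ℚ.toℚᵘ-homo-+ (+ b ℚ./ suc j) (+ 1 ℚ./ suc j) ⟨
    toℚᵘ (+ b ℚ./ suc j ℚ.+ + 1 ℚ./ suc j) ∎)
    where
    open ℚᵘ.≃-Reasoning
    d = + suc j
    cross : + suc b ℤ.* (d ℤ.* d) ≡ (+ b ℤ.* d ℤ.+ + 1 ℤ.* d) ℤ.* d
    cross = trans (sym (ℤ.*-assoc (+ suc b) d d)) (cong (ℤ._* d)
      (trans (cong (ℤ._* d) (cong +_ (ℕ.+-comm 1 b))) (ℤ.*-distribʳ-+ d (+ b) (+ 1))))

  archimedean : ∀ δ → 0ℚ ℚ.< δ → ∃ λ N → ∀ i → N ℕ.≤ i → + 1 ℚ./ suc i ℚ.≤ δ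
  archimedean δ@(mkℚ (+ suc n) d _) _ = d , λ i d≤i →
    subst (+ 1 ℚ./ suc i ℚ.≤_) (ℚ.↥p/↧p≡p δ)
      (/-mono-≤ 1 (suc n) i d (ℕ.*-mono-≤ {1} {suc n} (s≤s z≤n) (s≤s d≤i)))
  archimedean (mkℚ (+ 0) d _) (ℚ.*<* 0<0) = contradiction 0<0 (ℤ.<-irrefl refl)
  archimedean (mkℚ ℤ.-[1+ n ] d _) (ℚ.*<* ())

open Log₂-Lemmas

-- With a = ⌊log₂ Wⁿ⌋ we have 2ᵃ ≤ Wⁿ < 2ᵃ⁺¹, so a / n is within 1 / n of log₂ W.
log₂ : (W : ℕ) .{{_ : ℕ.NonZero W}} → ℝ
log₂ W = mkℝ approx cauchy
  where
  approx : ℕ → ℚ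
  approx i = + ⌊log₂ W ℕ.^ suc i ⌋ ℚ./ suc i
  half : ∀ i j → approx i ℚ.≤ approx j ℚ.+ + 1 ℚ./ suc j
  half i j = subst (approx i ℚ.≤_) (suc-/ ⌊log₂ W ℕ.^ suc j ⌋ j)
    (/-mono-≤ ⌊log₂ W ℕ.^ suc i ⌋ (suc ⌊log₂ W ℕ.^ suc j ⌋) i j (ℕ.<⇒≤ (log-cross W i j)))
  cauchy : IsCauchy approx
  cauchy δ 0<δ = let N , h = archimedean δ 0<δ in N , λ i j Ni Nj → ≈⇒∣-∣≤
    ( ℚ.≤-trans (half i j) (ℚ.+-monoʳ-≤ (approx j) (h j Nj))
    , ℚ.≤-trans (half j i) (ℚ.+-monoʳ-≤ (approx i) (h i Ni)))

-- The floor is a relation because it is not a computable function on ℝ.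
IsFloor : ℤ → ℝ → Set
IsFloor k x = fromℤ k ≤ x × x < fromℤ (k ℤ.+ + 1)

-- Streams are functions of time, with true for the bit 1.
Stream : Set
Stream = ℕ → Bool

-- The first t bits of a stream, most recent first.
arrived : Stream → ℕ → List Bool
arrived σ zero    = []
arrived σ (suc t) = σ t ∷ arrived σ t

ones : List Bool → ℕ
ones bs = sum (map (if_then 1 else 0) bs)

windowCount : ℕ → Stream → ℕ → ℕ
windowCount W σ t = ones (take W (arrived σ t))

record Algorithm (m : ℕ) : Set₁ where
  field
    Config  : Set
    encode  : Config ↣ Fin (2 ℕ.^ m)
    initial : Config
    step    : Config → Bool → Config
    answer  : Config → ℝ

  run : Stream → ℕ → Config
  run σ zero    = initial
  run σ (suc t) = step (run σ t) (σ t)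

Approximates : ∀ {m} → ℕ → ℝ → Algorithm m → Set
Approximates W ε A = ∀ σ t →
  ∣ fromℕ (windowCount W σ t) - answer (run σ t) ∣ ≤ fromℕ W * ε
  where open Algorithm A

{-# OPTIONS --safe #-}
module Submission where

-- Suppose the floor exceeds m, so that K = m + 1 is at most the maximum, and
-- let ε be at most 1/4. Two inputs that reach the same configuration get the
-- same answer, so their window counts differ by at most 2Wε (`resolves`).
-- Hence, whenever d > 2Wε, configurations tell counts at distance d apart;
-- this property of the algorithm, `Resolves`, is all that is used of the
-- approximation guarantee, and it is exploited twice.
--
-- Logarithmic bound (`window<2^1+m`). Feed W ones and then zeros. If the
-- configuration after i zeros recurs after j > i zeros, it recurs forever, in
-- particular when the window contains no 1 at all, whereas it contained W - i
-- of them after i zeros. Hence no configuration recurs that comes before the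
-- number W - i of remaining ones has dropped to 2Wε. As 2Wε is at most W/2,
-- this gives more than W/2 configurations, that is W < 2^(m+1), and then
-- log W < K strictly (`log₂<`).
--
-- Reciprocal bound (`blocks≤bits`). If K blocks of b equal bits fit in the
-- window and b resolves, all 2^K such inputs lead to distinct configurations:
-- take the most recent block where two inputs differ and append zeros until
-- everything older has left the window; the counts now differ by b. Hence
-- K is at most m.
--
-- Conclusion. Since log W < K, K is at most the reciprocal (`≤⊔⇒≤ʳ`), so
-- K (2Wε + 1) is at most W. With b the integer quotient of W by K we have
-- W < K (b + 1), hence 2Wε < b (`2Wε<quotient`), and K b is at most W. The
-- reciprocal bound gives m + 1 = K at most m, which is absurd.

open import Defs
open ℚ-Lemmas
open Log₂-Lemmas
open import Data.Bool using (Bool; true; false; if_then_else_; T)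
open import Data.Fin as Fin using (Fin)
import Data.Fin.Properties as Fin
open import Data.Integer as ℤ using (ℤ; +_; -[1+_])
open import Data.List using (List; []; _∷_; _++_; take; map; foldr; length; replicate)
import Data.List.Properties as List
open import Data.Nat as ℕ using (ℕ; zero; suc; s≤s; z≤n)
import Data.Nat.DivMod as ℕ
import Data.Nat.Properties as ℕ
open import Data.Nat.ListAction using (sum)
open import Data.Nat.ListAction.Properties using (sum-++)
open import Data.Nat.Logarithm using (⌊log₂_⌋)
open import Data.Nat.Tactic.RingSolver using (solve-∀)
open import Data.Product using (∃; _×_; _,_; proj₁; proj₂)
open import Data.Rational as ℚ using (ℚ; 0ℚ; 1ℚ; ½)
import Data.Rational.Properties as ℚ
open import Data.Rational.Solver using (module +-*-Solver)
open import Data.Sum using (inj₁; inj₂)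
open import Function.Base using (_∘_)
open import Function.Bundles using (Injection; Inverse)
open import Function.Properties.Inverse using (↔⇒↣)
open import Relation.Binary.PropositionalEquality
open import Relation.Nullary using (contradiction)

open Algorithm
open +-*-Solver

-- Naturals as rationals

infix 10 _/1

-- The rational n/1, which is the constant value of the real number fromℕ n.
_/1 : ℕ → ℚ
n /1 = + n ℚ./ 1

/1-mono-≤ : ∀ {a b} → a ℕ.≤ b → a /1 ℚ.≤ b /1
/1-mono-≤ {a} {b} a≤b = /-mono-≤ a b 0 0 (ℕ.*-monoˡ-≤ 1 a≤b)

/1-homo-+ : ∀ a b → (a ℕ.+ b) /1 ≡ a /1 ℚ.+ b /1
/1-homo-+ zero    b = sym (ℚ.+-identityˡ (b /1))
/1-homo-+ (suc a) b = begin
  suc (a ℕ.+ b) /1          ≡⟨ suc-/ (a ℕ.+ b) 0 ⟩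
  (a ℕ.+ b) /1 ℚ.+ 1ℚ       ≡⟨ cong (ℚ._+ 1ℚ) (/1-homo-+ a b) ⟩
  (a /1 ℚ.+ b /1) ℚ.+ 1ℚ    ≡⟨ solve 2 (λ a b → (a :+ b) :+ con 1ℚ := (a :+ con 1ℚ) :+ b) refl (a /1) (b /1) ⟩
  (a /1 ℚ.+ 1ℚ) ℚ.+ b /1    ≡⟨ cong (ℚ._+ b /1) (suc-/ a 0) ⟨
  suc a /1 ℚ.+ b /1         ∎
  where open ≡-Reasoning

/1-homo-* : ∀ a b → (a ℕ.* b) /1 ≡ a /1 ℚ.* b /1
/1-homo-* zero    b = sym (ℚ.*-zeroˡ (b /1))
/1-homo-* (suc a) b = begin
  (b ℕ.+ a ℕ.* b) /1              ≡⟨ /1-homo-+ b (a ℕ.* b) ⟩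
  b /1 ℚ.+ (a ℕ.* b) /1           ≡⟨ cong (b /1 ℚ.+_) (/1-homo-* a b) ⟩
  b /1 ℚ.+ a /1 ℚ.* b /1          ≡⟨ solve 2 (λ a b → b :+ a :* b := (a :+ con 1ℚ) :* b) refl (a /1) (b /1) ⟩
  (a /1 ℚ.+ 1ℚ) ℚ.* b /1          ≡⟨ cong (ℚ._* b /1) (suc-/ a 0) ⟨
  suc a /1 ℚ.* b /1               ∎
  where open ≡-Reasoning

/1*1/n : ∀ a j → a /1 ℚ.* (+ 1 ℚ./ suc j) ≡ + a ℚ./ suc j
/1*1/n zero    j = trans (ℚ.*-zeroˡ (+ 1 ℚ./ suc j))
  (ℚ.≤-antisym (/-mono-≤ 0 0 0 j z≤n) (/-mono-≤ 0 0 j 0 z≤n))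
/1*1/n (suc a) j = begin
  suc a /1 ℚ.* u          ≡⟨ cong (ℚ._* u) (suc-/ a 0) ⟩
  (a /1 ℚ.+ 1ℚ) ℚ.* u     ≡⟨ solve 2 (λ a u → (a :+ con 1ℚ) :* u := a :* u :+ u) refl (a /1) u ⟩
  a /1 ℚ.* u ℚ.+ u        ≡⟨ cong (ℚ._+ u) (/1*1/n a j) ⟩
  + a ℚ./ suc j ℚ.+ u     ≡⟨ suc-/ a j ⟨
  + suc a ℚ./ suc j       ∎
  where
  open ≡-Reasoning
  u : ℚ
  u = + 1 ℚ./ suc j

n*1/n≡1 : ∀ n .{{_ : ℕ.NonZero n}} → n /1 ℚ.* (+ 1 ℚ./ n) ≡ 1ℚ
n*1/n≡1 n@(suc j) = trans (/1*1/n n j) (ℚ.≤-antisym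
  (/-mono-≤ n 1 j 0 (ℕ.≤-reflexive (ℕ.*-comm n 1)))
  (/-mono-≤ 1 n 0 j (ℕ.≤-reflexive (ℕ.*-comm 1 n))))

1/n-pos : ∀ n .{{_ : ℕ.NonZero n}} → 0ℚ ℚ.< + 1 ℚ./ n
1/n-pos n = ℚ.positive⁻¹ (+ 1 ℚ./ n) {{ℚ.normalize-pos 1 n}}

p<p+q : ∀ p {q} → 0ℚ ℚ.< q → p ℚ.< p ℚ.+ q
p<p+q p {q} 0<q = subst (ℚ._< p ℚ.+ q) (ℚ.+-identityʳ p) (ℚ.+-monoʳ-< p 0<q)

½*p<p : ∀ {p} → 0ℚ ℚ.< p → ½ ℚ.* p ℚ.< p
½*p<p {p} 0<p = subst (½ ℚ.* p ℚ.<_) (½+½ p) (p<p+q (½ ℚ.* p) (½*-pos 0<p))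

0<q-p : ∀ {p q} → p ℚ.< q → 0ℚ ℚ.< q ℚ.- p
0<q-p {p} {q} p<q = subst (ℚ._< q ℚ.- p) (ℚ.+-inverseʳ p) (ℚ.+-monoˡ-< (ℚ.- p) p<q)

-- Real numbers

-- Constructively a number below a maximum need not be below a known one of the
-- two; the strict inequality x < z decides which. Once the tolerance is below
-- the gap between x and z, the maximum cannot be attained by x.
≤⊔⇒≤ʳ : ∀ {x y z} → z ≤ x ⊔ y → x < z → z ≤ y
≤⊔⇒≤ʳ {x} {y} {z} z≤x⊔y (g , 0<g , M , x+g≤z) δ 0<δ =
  let N , h = z≤x⊔y δ′ 0<δ′
  in M ℕ.⊔ N , λ i i≥ → bound i (x+g≤z i (ℕ.m⊔n≤o⇒m≤o M N i≥)) (h i (ℕ.m⊔n≤o⇒n≤o M N i≥))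
  where
  δ′ : ℚ
  δ′ = δ ℚ.⊓ (½ ℚ.* g)
  0<δ′ : 0ℚ ℚ.< δ′
  0<δ′ with ℚ.⊓-sel δ (½ ℚ.* g)
  ... | inj₁ e = subst (0ℚ ℚ.<_) (sym e) 0<δ
  ... | inj₂ e = subst (0ℚ ℚ.<_) (sym e) (½*-pos 0<g)
  bound : ∀ i → seq x i ℚ.+ g ℚ.≤ seq z i → seq z i ℚ.≤ (seq x i ℚ.⊔ seq y i) ℚ.+ δ′ →
          seq z i ℚ.≤ seq y i ℚ.+ δ
  bound i x+g≤z z≤ with ℚ.⊔-sel (seq x i) (seq y i)
  ... | inj₂ e = ℚ.≤-trans (subst (λ p → seq z i ℚ.≤ p ℚ.+ δ′) e z≤) (ℚ.+-monoʳ-≤ (seq y i) (ℚ.p⊓q≤p δ (½ ℚ.* g)))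
  ... | inj₁ e = contradiction (begin-strict
    seq z i              ≤⟨ subst (λ p → seq z i ℚ.≤ p ℚ.+ δ′) e z≤ ⟩
    seq x i ℚ.+ δ′       <⟨ ℚ.+-monoʳ-< (seq x i) (ℚ.≤-<-trans (ℚ.p⊓q≤q δ (½ ℚ.* g)) (½*p<p 0<g)) ⟩
    seq x i ℚ.+ g        ≤⟨ x+g≤z ⟩
    seq z i              ∎) (ℚ.<-irrefl refl)
    where open ℚ.≤-Reasoning

-- Beyond the point where x is at least its positive lower bound c, the maximum
-- in the definition of the reciprocal is inert.
⁻¹-inverse : ∀ x (p : 0ℝ < x) → let c , _ , N , _ = p in
  ∀ i → N ℕ.≤ i → c ℚ.≤ seq x i × seq (x ⁻¹⟨ p ⟩) i ℚ.* seq x i ≡ 1ℚ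
⁻¹-inverse x p@(c , 0<c , N , c≤x) i N≤i = c≤xᵢ ,
  trans (cong (seq (x ⁻¹⟨ p ⟩) i ℚ.*_) (sym c⊔xᵢ≡xᵢ))
    (ℚ.*-inverseˡ (c ℚ.⊔ seq x i) {{ℚ.>-nonZero (ℚ.<-≤-trans 0<c (ℚ.p≤p⊔q c (seq x i)))}})
  where
  c≤xᵢ : c ℚ.≤ seq x i
  c≤xᵢ = subst (ℚ._≤ seq x i) (ℚ.+-identityˡ c) (c≤x i N≤i)
  c⊔xᵢ≡xᵢ : c ℚ.⊔ seq x i ≡ seq x i
  c⊔xᵢ≡xᵢ = ℚ.p≤q⇒p⊔q≡q c≤xᵢ

-- From q ≤ 1/x and a < q b follows a x < b. Half of the gap q b - a
-- absorbs the tolerance δ in q ≤ 1/x + δ, and the other half times c, a lower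
-- bound of x, is the gap of the conclusion.
≤⁻¹⇒*< : ∀ {x p q a b} → fromℚ q ≤ x ⁻¹⟨ p ⟩ → 0ℚ ℚ.< b → a ℚ.< q ℚ.* b → fromℚ a * x < fromℚ b
≤⁻¹⇒*< {x} {p@(c , 0<c , M , _)} {q} {a} {b} q≤x⁻¹ 0<b a<qb =
  h ℚ.* c , *-pos 0<h 0<c , M ℕ.⊔ N , λ i i≥ →
    let c≤xᵢ , inv = ⁻¹-inverse x p i (ℕ.m⊔n≤o⇒m≤o M N i≥)
    in bound (seq x i) (seq (x ⁻¹⟨ p ⟩) i) c≤xᵢ inv (q≤ i (ℕ.m⊔n≤o⇒n≤o M N i≥))
  where
  h : ℚ
  h = ½ ℚ.* (q ℚ.* b ℚ.- a)
  0<h : 0ℚ ℚ.< h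
  0<h = ½*-pos (0<q-p a<qb)
  b⁻¹ : ℚ
  b⁻¹ = (ℚ.1/ b) {{ℚ.>-nonZero 0<b}}
  -- Chosen so that δ * b = h.
  δ : ℚ
  δ = h ℚ.* b⁻¹
  0<δ : 0ℚ ℚ.< δ
  0<δ = *-pos 0<h (ℚ.positive⁻¹ b⁻¹ {{ℚ.1/pos⇒pos b {{ℚ.positive 0<b}}}})
  N = proj₁ (q≤x⁻¹ δ 0<δ)
  q≤ = proj₂ (q≤x⁻¹ δ 0<δ)
  δ*b : δ ℚ.* b ≡ h
  δ*b = trans (ℚ.*-assoc h b⁻¹ b) (trans (cong (h ℚ.*_) (ℚ.*-inverseˡ b {{ℚ.>-nonZero 0<b}})) (ℚ.*-identityʳ h))
  bound : ∀ y z → c ℚ.≤ y → z ℚ.* y ≡ 1ℚ → q ℚ.≤ z ℚ.+ δ → a ℚ.* y ℚ.+ h ℚ.* c ℚ.≤ b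
  bound y z c≤y zy≡1 q≤z+δ = begin
    a ℚ.* y ℚ.+ h ℚ.* c
      ≤⟨ ℚ.+-monoʳ-≤ (a ℚ.* y) (ℚ.*-monoˡ-≤-nonNeg h {{ℚ.nonNegative (ℚ.<⇒≤ 0<h)}} c≤y) ⟩
    a ℚ.* y ℚ.+ h ℚ.* y
      ≡⟨ solve 4 (λ a q b y → a :* y :+ (con ½ :* (q :* b :- a)) :* y
                           := (q :* y) :* b :- (con ½ :* (q :* b :- a)) :* y) refl a q b y ⟩
    (q ℚ.* y) ℚ.* b ℚ.- h ℚ.* y
      ≤⟨ ℚ.+-monoˡ-≤ (ℚ.- (h ℚ.* y)) (ℚ.*-monoʳ-≤-nonNeg b {{ℚ.nonNegative (ℚ.<⇒≤ 0<b)}}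
          (ℚ.*-monoʳ-≤-nonNeg y {{ℚ.nonNegative (ℚ.≤-trans (ℚ.<⇒≤ 0<c) c≤y)}} q≤z+δ)) ⟩
    ((z ℚ.+ δ) ℚ.* y) ℚ.* b ℚ.- h ℚ.* y
      ≡⟨ solve 5 (λ z d y b h → ((z :+ d) :* y) :* b :- h :* y := (z :* y) :* b :+ (d :* b :- h) :* y) refl z δ y b h ⟩
    (z ℚ.* y) ℚ.* b ℚ.+ (δ ℚ.* b ℚ.- h) ℚ.* y
      ≡⟨ cong₂ (λ u v → u ℚ.* b ℚ.+ (v ℚ.- h) ℚ.* y) zy≡1 δ*b ⟩
    1ℚ ℚ.* b ℚ.+ (h ℚ.- h) ℚ.* y
      ≡⟨ solve 3 (λ b h y → con 1ℚ :* b :+ (h :- h) :* y := b) refl b h y ⟩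
    b ∎
    where open ℚ.≤-Reasoning

-- A strict upper bound for the logarithm

-- Bernoulli's inequality (1 + 1/w)^n ≥ 1 + n/w, multiplied by w^(n+1).
bernoulli : ∀ w n → (w ℕ.+ n) ℕ.* w ℕ.^ n ℕ.≤ w ℕ.* suc w ℕ.^ n
bernoulli w zero    = ℕ.*-monoˡ-≤ 1 (ℕ.≤-reflexive (ℕ.+-identityʳ w))
bernoulli w (suc n) = begin
  (w ℕ.+ suc n) ℕ.* (w ℕ.* w ℕ.^ n)              ≤⟨ ℕ.m≤m+n _ (n ℕ.* w ℕ.^ n) ⟩
  (w ℕ.+ suc n) ℕ.* (w ℕ.* w ℕ.^ n) ℕ.+ n ℕ.* w ℕ.^ n ≡⟨ rearrange w n (w ℕ.^ n) ⟩
  suc w ℕ.* ((w ℕ.+ n) ℕ.* w ℕ.^ n)              ≤⟨ ℕ.*-monoʳ-≤ (suc w) (bernoulli w n) ⟩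
  suc w ℕ.* (w ℕ.* suc w ℕ.^ n)                  ≡⟨ swap (suc w) w (suc w ℕ.^ n) ⟩
  w ℕ.* (suc w ℕ.* suc w ℕ.^ n)                  ∎
  where
  open ℕ.≤-Reasoning
  rearrange : ∀ w n x → (w ℕ.+ suc n) ℕ.* (w ℕ.* x) ℕ.+ n ℕ.* x ≡ suc w ℕ.* ((w ℕ.+ n) ℕ.* x)
  rearrange = solve-∀
  swap : ∀ a b x → a ℕ.* (b ℕ.* x) ≡ b ℕ.* (a ℕ.* x)
  swap = solve-∀

4*w^3w≤[1+w]^3w : ∀ w .{{_ : ℕ.NonZero w}} → 4 ℕ.* w ℕ.^ (3 ℕ.* w) ℕ.≤ suc w ℕ.^ (3 ℕ.* w)
4*w^3w≤[1+w]^3w w = ℕ.*-cancelˡ-≤ w (begin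
  w ℕ.* (4 ℕ.* x)            ≡⟨ rearrange w x ⟩
  (w ℕ.+ 3 ℕ.* w) ℕ.* x      ≤⟨ bernoulli w (3 ℕ.* w) ⟩
  w ℕ.* suc w ℕ.^ (3 ℕ.* w)  ∎)
  where
  open ℕ.≤-Reasoning
  x : ℕ
  x = w ℕ.^ (3 ℕ.* w)
  rearrange : ∀ w x → w ℕ.* (4 ℕ.* x) ≡ (w ℕ.+ 3 ℕ.* w) ℕ.* x
  rearrange = solve-∀

-- From W + 1 ≤ 2^K, taking the power n = 3W gains two bits: 4 W^n ≤ 2^(K n).
2+⌊log₂⌋≤K*n : ∀ W {K} .{{_ : ℕ.NonZero W}} → W ℕ.< 2 ℕ.^ K →
               let n = 3 ℕ.* W in 2 ℕ.+ ⌊log₂ W ℕ.^ n ⌋ ℕ.≤ K ℕ.* n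
2+⌊log₂⌋≤K*n W {K} W<2^K = ^-cancel-< (begin-strict
  2 ℕ.^ (1 ℕ.+ a)     <⟨ ℕ.^-monoʳ-< 2 (s≤s (s≤s z≤n)) (ℕ.n<1+n (suc a)) ⟩
  2 ℕ.^ (2 ℕ.+ a)     ≡⟨ ℕ.^-distribˡ-+-* 2 2 a ⟩
  4 ℕ.* 2 ℕ.^ a       ≤⟨ ℕ.*-monoʳ-≤ 4 (2^⌊log₂n⌋≤n (W ℕ.^ n) {{ℕ.m^n≢0 W n}}) ⟩
  4 ℕ.* W ℕ.^ n       ≤⟨ 4*w^3w≤[1+w]^3w W ⟩
  suc W ℕ.^ n         ≤⟨ ℕ.^-monoˡ-≤ n W<2^K ⟩
  (2 ℕ.^ K) ℕ.^ n     ≡⟨ ℕ.^-*-assoc 2 K n ⟩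
  2 ℕ.^ (K ℕ.* n)     ∎)
  where
  open ℕ.≤-Reasoning
  n a : ℕ
  n = 3 ℕ.* W
  a = ⌊log₂ W ℕ.^ n ⌋

-- Every term of the sequence of log₂ W is at most 1/n above the n-th one, a/n.
-- As (a + 2)/n ≤ K for n = 3W, each term is at most K - 1/n.
log₂< : ∀ {W K} .{{_ : ℕ.NonZero W}} → W ℕ.< 2 ℕ.^ K → log₂ W < fromℕ K
log₂< {W@(suc w)} {K} W<2^K = u , 1/n-pos n , 0 , λ i _ → begin
  seq (log₂ W) i ℚ.+ u
    ≤⟨ ℚ.+-monoˡ-≤ u (/-mono-≤ ⌊log₂ W ℕ.^ suc i ⌋ (suc a) i j (ℕ.<⇒≤ (log-cross W i j))) ⟩
  + suc a ℚ./ n ℚ.+ u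
    ≡⟨ suc-/ (suc a) j ⟨
  + (2 ℕ.+ a) ℚ./ n
    ≤⟨ /-mono-≤ (2 ℕ.+ a) K j 0
         (subst (ℕ._≤ K ℕ.* n) (sym (ℕ.*-identityʳ (2 ℕ.+ a))) (2+⌊log₂⌋≤K*n W {K} W<2^K)) ⟩
  K /1 ∎
  where
  open ℚ.≤-Reasoning
  -- The terms of the sequence are indexed from 0, and n = 3 * W.
  j n a : ℕ
  j = w ℕ.+ 2 ℕ.* W
  n = suc j
  a = ⌊log₂ W ℕ.^ n ⌋
  u : ℚ
  u = + 1 ℚ./ n

-- Counts sharing a configuration

-- Reaching a common configuration forces the counts to differ by less than d.
-- It is enough to say so on one side, as the two inputs can be exchanged.
Resolves : ∀ {m} → ℕ → Algorithm m → ℕ → Set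
Resolves W A d = ∀ σ t σ′ t′ → run A σ t ≡ run A σ′ t′ →
  windowCount W σ t ℕ.< d ℕ.+ windowCount W σ′ t′

-- The length of the interval of counts compatible with a given answer.
2Wε : ℕ → ℝ → ℝ
2Wε W ε = fromℕ 2 * (fromℕ W * ε)

resolves : ∀ {m W ε d} (A : Algorithm m) → Approximates W ε A → 2Wε W ε < fromℕ d →
  Resolves W A d
resolves {W = W} {ε} {d} A approx (g , 0<g , L , 2Wε+g≤d) σ t σ′ t′ e =
  let M , near  = approx σ t δ 0<δ
      N , near′ = subst (λ c → ∣ fromℕ (windowCount W σ′ t′) - answer A c ∣ ≤ fromℕ W * ε)
                    (sym e) (approx σ′ t′) δ 0<δ
      i = L ℕ.⊔ (M ℕ.⊔ N)
      M⊔N≤i = ℕ.m≤n⊔m L (M ℕ.⊔ N)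
  in close (seq (answer A (run A σ t)) i) (seq (fromℕ W * ε) i)
       (2Wε+g≤d i (ℕ.m≤m⊔n L (M ℕ.⊔ N)))
       (near i (ℕ.m⊔n≤o⇒m≤o M N M⊔N≤i))
       (near′ i (ℕ.m⊔n≤o⇒n≤o M N M⊔N≤i))
  where
  C C′ : ℚ
  C  = windowCount W σ t /1
  C′ = windowCount W σ′ t′ /1
  δ : ℚ
  δ = ½ ℚ.* (½ ℚ.* g)
  0<δ : 0ℚ ℚ.< δ
  0<δ = ½*-pos (½*-pos 0<g)
  -- Here a and v are terms of the common answer and of Wε.
  close : ∀ a v → 2 /1 ℚ.* v ℚ.+ g ℚ.≤ d /1 →
          (C ℚ.- a) ℚ.⊔ ℚ.- (C ℚ.- a) ℚ.≤ v ℚ.+ δ → (C′ ℚ.- a) ℚ.⊔ ℚ.- (C′ ℚ.- a) ℚ.≤ v ℚ.+ δ →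
          windowCount W σ t ℕ.< d ℕ.+ windowCount W σ′ t′
  close a v 2v+g≤d C≈a C′≈a = ℕ.≰⇒> λ d+C′≤C → ℚ.<-irrefl refl (begin-strict
    C
      ≡⟨ solve 3 (λ C C′ a → C := C′ :+ ((C :- a) :+ (:- (C′ :- a)))) refl C C′ a ⟩
    C′ ℚ.+ ((C ℚ.- a) ℚ.+ (ℚ.- (C′ ℚ.- a)))
      ≤⟨ ℚ.+-monoʳ-≤ C′ (ℚ.+-mono-≤ (ℚ.p⊔q≤r⇒p≤r (C ℚ.- a) (ℚ.- (C ℚ.- a)) C≈a)
                                     (ℚ.p⊔q≤r⇒q≤r (C′ ℚ.- a) (ℚ.- (C′ ℚ.- a)) C′≈a)) ⟩
    C′ ℚ.+ ((v ℚ.+ δ) ℚ.+ (v ℚ.+ δ))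
      ≡⟨ solve 3 (λ C′ v g → let δ = con ½ :* (con ½ :* g) in
           C′ :+ ((v :+ δ) :+ (v :+ δ)) := (C′ :+ con (2 /1) :* v) :+ con ½ :* g) refl C′ v g ⟩
    (C′ ℚ.+ 2 /1 ℚ.* v) ℚ.+ ½ ℚ.* g
      <⟨ ℚ.+-monoʳ-< (C′ ℚ.+ 2 /1 ℚ.* v) (½*p<p 0<g) ⟩
    (C′ ℚ.+ 2 /1 ℚ.* v) ℚ.+ g
      ≡⟨ solve 3 (λ C′ w g → (C′ :+ w) :+ g := (w :+ g) :+ C′) refl C′ (2 /1 ℚ.* v) g ⟩
    (2 /1 ℚ.* v ℚ.+ g) ℚ.+ C′
      ≤⟨ ℚ.+-monoˡ-≤ C′ 2v+g≤d ⟩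
    d /1 ℚ.+ C′
      ≡⟨ /1-homo-+ d (windowCount W σ′ t′) ⟨
    (d ℕ.+ windowCount W σ′ t′) /1
      ≤⟨ /1-mono-≤ {d ℕ.+ windowCount W σ′ t′} {windowCount W σ t} d+C′≤C ⟩
    C ∎)
    where open ℚ.≤-Reasoning

1+n≤2*[1+⌊n/2⌋] : ∀ n → suc n ℕ.≤ 2 ℕ.* suc ℕ.⌊ n /2⌋
1+n≤2*[1+⌊n/2⌋] n = begin
  suc n                           ≡⟨ cong suc (ℕ.⌊n/2⌋+⌈n/2⌉≡n n) ⟨
  suc ℕ.⌊ n /2⌋ ℕ.+ ℕ.⌈ n /2⌉     ≤⟨ ℕ.+-monoʳ-≤ (suc ℕ.⌊ n /2⌋) (ℕ.⌊n/2⌋-mono (ℕ.n≤1+n (suc n))) ⟩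
  suc ℕ.⌊ n /2⌋ ℕ.+ suc ℕ.⌊ n /2⌋ ≡⟨ cong (suc ℕ.⌊ n /2⌋ ℕ.+_) (ℕ.+-identityʳ (suc ℕ.⌊ n /2⌋)) ⟨
  2 ℕ.* suc ℕ.⌊ n /2⌋             ∎
  where open ℕ.≤-Reasoning

-- As 2Wε ≤ W/2 ≤ (1 + ⌊W/2⌋) - 1/2, a gap of 1/4 is left after allowing 1/4 for
-- the tolerance in ε ≤ 1/4, which gets multiplied by 2W.
2Wε<1+⌊W/2⌋ : ∀ W .{{_ : ℕ.NonZero W}} {ε} → ε ≤ fromℚ (+ 1 ℚ./ 4) → 2Wε W ε < fromℕ (suc ℕ.⌊ W /2⌋)
2Wε<1+⌊W/2⌋ W {ε} ε≤¼ =
  let N , h = ε≤¼ δ 0<δ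
  in ¼ , ℚ.positive⁻¹ ¼ , N , λ i N≤i → bound (seq ε i) (h i N≤i)
  where
  ¼ δ w u : ℚ
  ¼ = + 1 ℚ./ 4
  w = W /1
  u = + 1 ℚ./ W
  δ = ½ ℚ.* (¼ ℚ.* u)
  0<δ : 0ℚ ℚ.< δ
  0<δ = ½*-pos (*-pos (ℚ.positive⁻¹ ¼) (1/n-pos W))
  d : ℕ
  d = suc ℕ.⌊ W /2⌋
  open ℚ.≤-Reasoning
  bound : ∀ e → e ℚ.≤ ¼ ℚ.+ δ → 2 /1 ℚ.* (w ℚ.* e) ℚ.+ ¼ ℚ.≤ d /1
  bound e e≤¼+δ = begin
    2 /1 ℚ.* (w ℚ.* e) ℚ.+ ¼
      ≤⟨ ℚ.+-monoˡ-≤ ¼ (ℚ.*-monoˡ-≤-nonNeg (2 /1)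
           (ℚ.*-monoˡ-≤-nonNeg w {{ℚ.nonNegative (/1-mono-≤ {0} {W} z≤n)}} e≤¼+δ)) ⟩
    2 /1 ℚ.* (w ℚ.* (¼ ℚ.+ δ)) ℚ.+ ¼
      ≡⟨ solve 2 (λ w u → con (2 /1) :* (w :* (con ¼ :+ con ½ :* (con ¼ :* u))) :+ con ¼
                       := con ½ :* (w :+ con ½ :* (w :* u) :+ con ½)) refl w u ⟩
    ½ ℚ.* (w ℚ.+ ½ ℚ.* (w ℚ.* u) ℚ.+ ½)
      ≡⟨ cong (λ x → ½ ℚ.* (w ℚ.+ ½ ℚ.* x ℚ.+ ½)) (n*1/n≡1 W) ⟩
    ½ ℚ.* (w ℚ.+ ½ ℚ.* 1ℚ ℚ.+ ½)
      ≡⟨ cong (½ ℚ.*_) (trans (ℚ.+-assoc w ½ ½) (sym (suc-/ W 0))) ⟩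
    ½ ℚ.* suc W /1
      ≤⟨ ℚ.*-monoˡ-≤-nonNeg ½ (/1-mono-≤ {suc W} {2 ℕ.* d} (1+n≤2*[1+⌊n/2⌋] W)) ⟩
    ½ ℚ.* (2 ℕ.* d) /1
      ≡⟨ cong (½ ℚ.*_) (/1-homo-* 2 d) ⟩
    ½ ℚ.* (2 /1 ℚ.* d /1)
      ≡⟨ solve 1 (λ d → con ½ :* (con (2 /1) :* d) := d) refl (d /1) ⟩
    d /1 ∎

-- The hypotheses give W (2ε + 1/W) < b + 1, and this product is 2Wε + 1.
2Wε<quotient : ∀ W .{{_ : ℕ.NonZero W}} {ε p K b} →
  fromℕ K ≤ (fromℕ 2 * ε + fromℚ (+ 1 ℚ./ W)) ⁻¹⟨ p ⟩ → W ℕ.< K ℕ.* suc b → 2Wε W ε < fromℕ b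
2Wε<quotient W {ε} {p} {K} {b} K≤inv W<K[1+b] =
  let g , 0<g , N , h = ≤⁻¹⇒*< {fromℕ 2 * ε + fromℚ u} {p} {K /1} {w} {suc b /1} K≤inv (0<1+n b) W/1<
  in g , 0<g , N , λ i N≤i → bound (seq ε i) g (h i N≤i)
  where
  w u : ℚ
  w = W /1
  u = + 1 ℚ./ W
  open ℚ.≤-Reasoning
  0<1+n : ∀ n → 0ℚ ℚ.< suc n /1
  0<1+n n = ℚ.<-≤-trans (ℚ.positive⁻¹ 1ℚ) (/1-mono-≤ (s≤s (z≤n {n})))
  W/1< : w ℚ.< K /1 ℚ.* suc b /1
  W/1< = begin-strict
    w                       <⟨ p<p+q w (ℚ.positive⁻¹ 1ℚ) ⟩
    w ℚ.+ 1ℚ                ≡⟨ suc-/ W 0 ⟨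
    suc W /1                ≤⟨ /1-mono-≤ W<K[1+b] ⟩
    (K ℕ.* suc b) /1        ≡⟨ /1-homo-* K (suc b) ⟩
    K /1 ℚ.* suc b /1       ∎
  bound : ∀ e g → w ℚ.* (2 /1 ℚ.* e ℚ.+ u) ℚ.+ g ℚ.≤ suc b /1 → 2 /1 ℚ.* (w ℚ.* e) ℚ.+ g ℚ.≤ b /1
  bound e g h = begin
    2 /1 ℚ.* (w ℚ.* e) ℚ.+ g
      ≡⟨ solve 4 (λ w u e g → con (2 /1) :* (w :* e) :+ g
           := (w :* (con (2 /1) :* e :+ u) :+ g) :- w :* u) refl w u e g ⟩
    (w ℚ.* (2 /1 ℚ.* e ℚ.+ u) ℚ.+ g) ℚ.- w ℚ.* u
      ≤⟨ ℚ.+-monoˡ-≤ (ℚ.- (w ℚ.* u)) h ⟩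
    suc b /1 ℚ.- w ℚ.* u
      ≡⟨ cong₂ ℚ._-_ (suc-/ b 0) (n*1/n≡1 W) ⟩
    (b /1 ℚ.+ 1ℚ) ℚ.- 1ℚ
      ≡⟨ solve 1 (λ b → (b :+ con 1ℚ) :- con 1ℚ := b) refl (b /1) ⟩
    b /1 ∎

-- Inputs as lists of bits

-- The configuration after the given bits. All lists of bits have the most recent
-- bit first, so in xs ++ ys the bits of ys arrive before those of xs.
after : ∀ {m} (A : Algorithm m) → List Bool → Config A
after A = foldr (λ b c → step A c b) (initial A)

run≡after : ∀ {m} (A : Algorithm m) σ t → run A σ t ≡ after A (arrived σ t)
run≡after A σ zero    = refl
run≡after A σ (suc t) = cong (λ c → step A c (σ t)) (run≡after A σ t)

after-++ : ∀ {m} (A : Algorithm m) xs {ys zs} → after A ys ≡ after A zs →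
           after A (xs ++ ys) ≡ after A (xs ++ zs)
after-++ A []       e = e
after-++ A (x ∷ xs) e = cong (λ c → step A c x) (after-++ A xs e)

arrived-cong : ∀ {σ τ : Stream} t → (∀ {i} → i ℕ.< t → σ i ≡ τ i) → arrived σ t ≡ arrived τ t
arrived-cong zero    h = refl
arrived-cong (suc t) h = cong₂ _∷_ (h ℕ.≤-refl) (arrived-cong t (h ∘ ℕ.m<n⇒m<1+n))

-- A stream starting with the given bits. The last of them to arrive, b, comes at
-- time length bs; it is also repeated forever after, which is immaterial.
stream : List Bool → Stream
stream []       t = false
stream (b ∷ bs) t = if t ℕ.<ᵇ length bs then stream bs t else b

arrived-stream : ∀ bs → arrived (stream bs) (length bs) ≡ bs
arrived-stream []       = refl
arrived-stream (b ∷ bs) = cong₂ _∷_ last (trans (arrived-cong (length bs) earlier) (arrived-stream bs))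
  where
  last : stream (b ∷ bs) (length bs) ≡ b
  last with length bs ℕ.<ᵇ length bs in eq
  ... | false = refl
  ... | true  = contradiction (ℕ.<ᵇ⇒< (length bs) (length bs) (subst T (sym eq) _)) (ℕ.n≮n _)
  earlier : ∀ {i} → i ℕ.< length bs → stream (b ∷ bs) i ≡ stream bs i
  earlier {i} i<n with i ℕ.<ᵇ length bs in eq
  ... | true  = refl
  ... | false = contradiction (subst T eq (ℕ.<⇒<ᵇ i<n)) λ ()

-- Every list of bits is the beginning of a stream, so resolution may be stated
-- for lists.
resolves-lists : ∀ {m W d} (A : Algorithm m) → Resolves W A d → ∀ bs cs → after A bs ≡ after A cs →
                 ones (take W bs) ℕ.< d ℕ.+ ones (take W cs)
resolves-lists {W = W} {d} A res bs cs e =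
  subst₂ (λ xs ys → ones (take W xs) ℕ.< d ℕ.+ ones (take W ys)) (arrived-stream bs) (arrived-stream cs)
    (res (stream bs) (length bs) (stream cs) (length cs) (trans (run≡ bs) (trans e (sym (run≡ cs)))))
  where
  run≡ : ∀ xs → run A (stream xs) (length xs) ≡ after A xs
  run≡ xs = trans (run≡after A (stream xs) (length xs)) (cong (after A) (arrived-stream xs))

ones-++ : ∀ xs ys → ones (xs ++ ys) ≡ ones xs ℕ.+ ones ys
ones-++ xs ys = trans (cong sum (List.map-++ (if_then 1 else 0) xs ys))
  (sum-++ (map (if_then 1 else 0) xs) (map (if_then 1 else 0) ys))

ones-zeros : ∀ n → ones (replicate n false) ≡ 0
ones-zeros zero    = refl
ones-zeros (suc n) = ones-zeros n

ones-ones : ∀ n → ones (replicate n true) ≡ n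
ones-ones zero    = refl
ones-ones (suc n) = cong suc (ones-ones n)

take-replicate-++ : ∀ {X : Set} n k (x : X) ys →
  take (n ℕ.+ k) (replicate n x ++ ys) ≡ replicate n x ++ take k ys
take-replicate-++ zero    k x ys = refl
take-replicate-++ (suc n) k x ys = cong (x ∷_) (take-replicate-++ n k x ys)

take-length-++ : ∀ {X : Set} (xs ys : List X) → take (length xs) (xs ++ ys) ≡ xs
take-length-++ []       ys = refl
take-length-++ (x ∷ xs) ys = cong (x ∷_) (take-length-++ xs ys)

take-all-replicate : ∀ {X : Set} n W (x : X) ys → W ℕ.≤ n → take W (replicate n x ++ ys) ≡ replicate W x
take-all-replicate n       zero    x ys _         = refl
take-all-replicate (suc n) (suc W) x ys (s≤s W≤n) = cong (x ∷_) (take-all-replicate n W x ys W≤n)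

replicate-++ : ∀ {X : Set} n k (x : X) ys →
  replicate (n ℕ.+ k) x ++ ys ≡ replicate n x ++ (replicate k x ++ ys)
replicate-++ zero    k x ys = refl
replicate-++ (suc n) k x ys = cong (x ∷_) (replicate-++ n k x ys)

-- Logarithmic bound

-- A configuration that recurs after p zeros recurs after every multiple of p.
zeros-cycle : ∀ {m} (A : Algorithm m) i p bs →
  after A (replicate (p ℕ.+ i) false ++ bs) ≡ after A (replicate i false ++ bs) →
  ∀ n → after A (replicate (n ℕ.* p ℕ.+ i) false ++ bs) ≡ after A (replicate i false ++ bs)
zeros-cycle A i p bs e zero    = refl
zeros-cycle A i p bs e (suc n) = begin
  after A (replicate (p ℕ.+ n ℕ.* p ℕ.+ i) false ++ bs)
    ≡⟨ cong (λ k → after A (replicate k false ++ bs)) (ℕ.+-assoc p (n ℕ.* p) i) ⟩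
  after A (replicate (p ℕ.+ (n ℕ.* p ℕ.+ i)) false ++ bs)
    ≡⟨ cong (after A) (replicate-++ p (n ℕ.* p ℕ.+ i) false bs) ⟩
  after A (replicate p false ++ (replicate (n ℕ.* p ℕ.+ i) false ++ bs))
    ≡⟨ after-++ A (replicate p false) (zeros-cycle A i p bs e n) ⟩
  after A (replicate p false ++ (replicate i false ++ bs))
    ≡⟨ cong (after A) (replicate-++ p i false bs) ⟨
  after A (replicate (p ℕ.+ i) false ++ bs)
    ≡⟨ e ⟩
  after A (replicate i false ++ bs) ∎
  where open ≡-Reasoning

-- W ones followed in time by i zeros. The empty tail matches the shape of the
-- lemmas on replicate.
fading : ℕ → ℕ → List Bool
fading W i = replicate i false ++ replicate W true ++ []

-- A repetition is possible only once fewer than d ones are left in the window.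
fading-repeat : ∀ {m W d} (A : Algorithm m) → Resolves W A d → ∀ {i j} → i ℕ.≤ W → i ℕ.< j →
  after A (fading W i) ≡ after A (fading W j) → W ℕ.< d ℕ.+ i
fading-repeat {W = W} {d} A res {i} {j} i≤W i<j e = begin-strict
  W                                    ≡⟨ ℕ.m∸n+n≡m i≤W ⟨
  W ℕ.∸ i ℕ.+ i                        ≡⟨ cong (ℕ._+ i) early ⟨
  ones (take W (fading W i)) ℕ.+ i     <⟨ ℕ.+-monoˡ-< i (resolves-lists {W = W} {d} A res (fading W i) (fading W t) (sym cycle)) ⟩
  d ℕ.+ ones (take W (fading W t)) ℕ.+ i ≡⟨ cong (λ c → d ℕ.+ c ℕ.+ i) late ⟩
  d ℕ.+ 0 ℕ.+ i                        ≡⟨ cong (ℕ._+ i) (ℕ.+-identityʳ d) ⟩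
  d ℕ.+ i                              ∎
  where
  open ℕ.≤-Reasoning
  -- A whole number of periods after i, and at least W zeros.
  p t : ℕ
  p = j ℕ.∸ i
  t = W ℕ.* p ℕ.+ i
  cycle : after A (fading W t) ≡ after A (fading W i)
  cycle = zeros-cycle A i p (replicate W true ++ [])
    (trans (cong (λ k → after A (fading W k)) (ℕ.m∸n+n≡m (ℕ.<⇒≤ i<j))) (sym e)) W
  W≤t : W ℕ.≤ t
  W≤t = ℕ.≤-trans (ℕ.m≤m*n W p {{ℕ.>-nonZero (ℕ.m<n⇒0<n∸m i<j)}}) (ℕ.m≤m+n (W ℕ.* p) i)
  late : ones (take W (fading W t)) ≡ 0
  late = trans (cong ones (take-all-replicate t W false _ W≤t)) (ones-zeros W)
  early : ones (take W (fading W i)) ≡ W ℕ.∸ i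
  early = begin-equality
    ones (take W (fading W i))                           ≡⟨ cong (λ k → ones (take k (fading W i))) (ℕ.m+[n∸m]≡n i≤W) ⟨
    ones (take (i ℕ.+ (W ℕ.∸ i)) (fading W i))           ≡⟨ cong ones (take-replicate-++ i (W ℕ.∸ i) false _) ⟩
    ones (replicate i false ++ take (W ℕ.∸ i) (replicate W true ++ []))
      ≡⟨ cong (λ xs → ones (replicate i false ++ xs)) (take-all-replicate W (W ℕ.∸ i) true [] (ℕ.m∸n≤m W i)) ⟩
    ones (replicate i false ++ replicate (W ℕ.∸ i) true) ≡⟨ ones-++ (replicate i false) (replicate (W ℕ.∸ i) true) ⟩
    ones (replicate i false) ℕ.+ ones (replicate (W ℕ.∸ i) true) ≡⟨ cong₂ ℕ._+_ (ones-zeros i) (ones-ones (W ℕ.∸ i)) ⟩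
    W ℕ.∸ i ∎

-- The pigeonhole principle for memory.
collision : ∀ {m n} (A : Algorithm m) → 2 ℕ.^ m ℕ.< n → (f : Fin n → List Bool) →
            ∃ λ i → ∃ λ j → i Fin.< j × after A (f i) ≡ after A (f j)
collision A 2^m<n f =
  let i , j , i<j , e = Fin.pigeonhole 2^m<n (Injection.to (encode A) ∘ after A ∘ f)
  in i , j , i<j , Injection.injective (encode A) e

-- Among the configurations after 0, ..., ⌈W/2⌉ zeros, a repetition would start at
-- some i < ⌈W/2⌉, where at least 1 + ⌊W/2⌋ ones are left. So they are distinct.
window<2^1+m : ∀ {m W} (A : Algorithm m) → Resolves W A (suc ℕ.⌊ W /2⌋) → W ℕ.< 2 ℕ.^ suc m
window<2^1+m {m} {W} A res = ℕ.≰⇒> λ 2^1+m≤W →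
  let i , j , i<j , e = collision A (s≤s (2^m≤⌈W/2⌉ 2^1+m≤W)) (fading W ∘ Fin.toℕ)
      i<⌈W/2⌉ = ℕ.≤-trans i<j (Fin.toℕ≤pred[n] j)
      i≤W = ℕ.≤-trans (ℕ.<⇒≤ i<⌈W/2⌉) (ℕ.⌈n/2⌉≤n W)
  in ℕ.<⇒≱ (fading-repeat A res i≤W i<j e) (begin
    suc ℕ.⌊ W /2⌋ ℕ.+ Fin.toℕ i   ≡⟨ ℕ.+-suc ℕ.⌊ W /2⌋ (Fin.toℕ i) ⟨
    ℕ.⌊ W /2⌋ ℕ.+ suc (Fin.toℕ i) ≤⟨ ℕ.+-monoʳ-≤ ℕ.⌊ W /2⌋ i<⌈W/2⌉ ⟩
    ℕ.⌊ W /2⌋ ℕ.+ ℕ.⌈ W /2⌉       ≡⟨ ℕ.⌊n/2⌋+⌈n/2⌉≡n W ⟩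
    W                             ∎)
  where
  open ℕ.≤-Reasoning
  2^m≤⌈W/2⌉ : 2 ℕ.^ suc m ℕ.≤ W → 2 ℕ.^ m ℕ.≤ ℕ.⌈ W /2⌉
  2^m≤⌈W/2⌉ h = begin
    2 ℕ.^ m                             ≡⟨ ℕ.n≡⌈n+n/2⌉ (2 ℕ.^ m) ⟩
    ℕ.⌈ 2 ℕ.^ m ℕ.+ 2 ℕ.^ m /2⌉         ≡⟨ cong (λ n → ℕ.⌈ 2 ℕ.^ m ℕ.+ n /2⌉) (ℕ.+-identityʳ (2 ℕ.^ m)) ⟨
    ℕ.⌈ 2 ℕ.^ suc m /2⌉                 ≤⟨ ℕ.⌈n/2⌉-mono h ⟩
    ℕ.⌈ W /2⌉                           ∎

-- Reciprocal bound

-- Each letter of the word repeated b times, the first letter being the most recent.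
blocks : ∀ {K} → ℕ → (Fin K → Bool) → List Bool
blocks {zero}  b w = []
blocks {suc K} b w = replicate b (w Fin.zero) ++ blocks b (w ∘ Fin.suc)

-- Appending zeros after xs until xs fills the old end of the window leaves
-- exactly the ones of xs inside it.
ones-aligned : ∀ W xs ys → length xs ℕ.≤ W →
  ones (take W (replicate (W ℕ.∸ length xs) false ++ (xs ++ ys))) ≡ ones xs
ones-aligned W xs ys fits = begin
  ones (take W (replicate gap false ++ (xs ++ ys)))
    ≡⟨ cong (λ k → ones (take k (replicate gap false ++ (xs ++ ys)))) (ℕ.m∸n+n≡m fits) ⟨
  ones (take (gap ℕ.+ length xs) (replicate gap false ++ (xs ++ ys)))
    ≡⟨ cong ones (take-replicate-++ gap (length xs) false (xs ++ ys)) ⟩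
  ones (replicate gap false ++ take (length xs) (xs ++ ys))
    ≡⟨ cong (λ zs → ones (replicate gap false ++ zs)) (take-length-++ xs ys) ⟩
  ones (replicate gap false ++ xs)
    ≡⟨ ones-++ (replicate gap false) xs ⟩
  ones (replicate gap false) ℕ.+ ones xs
    ≡⟨ cong (ℕ._+ ones xs) (ones-zeros gap) ⟩
  ones xs ∎
  where
  open ≡-Reasoning
  gap : ℕ
  gap = W ℕ.∸ length xs

length-++-replicate : ∀ {X : Set} (xs : List X) n x → length (xs ++ replicate n x) ≡ length xs ℕ.+ n
length-++-replicate xs n x = trans (List.length-++ xs) (cong (length xs ℕ.+_) (List.length-replicate n))

-- The list p holds the more recent blocks, common to both inputs; xs and ys hold
-- the older ones, which are pushed out of the window.
leading-block : ∀ {m W b} (A : Algorithm m) → Resolves W A b → ∀ p xs ys → length p ℕ.+ b ℕ.≤ W →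
  after A ((p ++ replicate b true) ++ xs) ≢ after A ((p ++ replicate b false) ++ ys)
leading-block {W = W} {b} A res p xs ys fits e = ℕ.<-irrefl refl (begin-strict
  ones p ℕ.+ b                  ≡⟨ cong (ones p ℕ.+_) (ones-ones b) ⟨
  ones p ℕ.+ ones (replicate b true) ≡⟨ count true xs ⟨
  ones (take W (padded true xs))
    <⟨ resolves-lists {W = W} {b} A res (padded true xs) (padded false ys) (after-++ A (replicate gap false) e) ⟩
  b ℕ.+ ones (take W (padded false ys)) ≡⟨ cong (b ℕ.+_) (count false ys) ⟩
  b ℕ.+ (ones p ℕ.+ ones (replicate b false)) ≡⟨ cong (λ n → b ℕ.+ (ones p ℕ.+ n)) (ones-zeros b) ⟩
  b ℕ.+ (ones p ℕ.+ 0)          ≡⟨ cong (b ℕ.+_) (ℕ.+-identityʳ (ones p)) ⟩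
  b ℕ.+ ones p                  ≡⟨ ℕ.+-comm b (ones p) ⟩
  ones p ℕ.+ b                  ∎)
  where
  open ℕ.≤-Reasoning
  gap : ℕ
  gap = W ℕ.∸ (length p ℕ.+ b)
  padded : Bool → List Bool → List Bool
  padded x zs = replicate gap false ++ ((p ++ replicate b x) ++ zs)
  count : ∀ x zs → ones (take W (padded x zs)) ≡ ones p ℕ.+ ones (replicate b x)
  count x zs = trans
    (subst (λ n → ones (take W (replicate (W ℕ.∸ n) false ++ (q ++ zs))) ≡ ones q) len
      (ones-aligned W q zs (subst (ℕ._≤ W) (sym len) fits)))
    (ones-++ p (replicate b x))
    where
    q : List Bool
    q = p ++ replicate b x
    len : length q ≡ length p ℕ.+ b
    len = length-++-replicate p b x

leading-bit : ∀ {m W b} (A : Algorithm m) → Resolves W A b → ∀ p x y xs ys → length p ℕ.+ b ℕ.≤ W →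
  after A ((p ++ replicate b x) ++ xs) ≡ after A ((p ++ replicate b y) ++ ys) → x ≡ y
leading-bit A res p true  true  xs ys fits e = refl
leading-bit A res p false false xs ys fits e = refl
leading-bit A res p true  false xs ys fits e = contradiction e (leading-block A res p xs ys fits)
leading-bit A res p false true  xs ys fits e = contradiction (sym e) (leading-block A res p ys xs fits)

-- In the induction, p collects the blocks of the letters already compared, which
-- are equal in both inputs.
blocks-injective : ∀ {m W b} (A : Algorithm m) → Resolves W A b → ∀ {K} (v w : Fin K → Bool) p →
  length p ℕ.+ K ℕ.* b ℕ.≤ W → after A (p ++ blocks b v) ≡ after A (p ++ blocks b w) → v ≗ w
blocks-injective {W = W} {b} A res {suc K} v w p fits e = λ
  { Fin.zero    → first
  ; (Fin.suc i) → blocks-injective A res (v ∘ Fin.suc) (w ∘ Fin.suc) (p ++ replicate b x) fits′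
      (subst (λ z → after A ((p ++ replicate b x) ++ blocks b (v ∘ Fin.suc))
                  ≡ after A ((p ++ replicate b z) ++ blocks b (w ∘ Fin.suc))) (sym first) e′) i }
  where
  x y : Bool
  x = v Fin.zero
  y = w Fin.zero
  e′ : after A ((p ++ replicate b x) ++ blocks b (v ∘ Fin.suc))
     ≡ after A ((p ++ replicate b y) ++ blocks b (w ∘ Fin.suc))
  e′ = trans (cong (after A) (List.++-assoc p (replicate b x) _))
    (trans e (cong (after A) (sym (List.++-assoc p (replicate b y) _))))
  first : x ≡ y
  first = leading-bit A res p x y _ _
    (ℕ.≤-trans (ℕ.+-monoʳ-≤ (length p) (ℕ.m≤m+n b (K ℕ.* b))) fits) e′
  fits′ : length (p ++ replicate b x) ℕ.+ K ℕ.* b ℕ.≤ W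
  fits′ = subst (ℕ._≤ W) (trans (sym (ℕ.+-assoc (length p) b (K ℕ.* b)))
    (cong (ℕ._+ K ℕ.* b) (sym (length-++-replicate p b x)))) fits

-- The binary words of length K, indexed by the numbers below 2^K.
word : ∀ K → Fin (2 ℕ.^ K) → Fin K → Bool
word K k = Inverse.to Fin.2↔Bool ∘ Fin.finToFun {2} {K} k

funToFin-cong : ∀ {m n} {f g : Fin m → Fin n} → f ≗ g → Fin.funToFin f ≡ Fin.funToFin g
funToFin-cong {zero}  f≗g = refl
funToFin-cong {suc m} f≗g = cong₂ Fin.combine (f≗g Fin.zero) (funToFin-cong (f≗g ∘ Fin.suc))

word-injective : ∀ K {i j} → word K i ≗ word K j → i ≡ j
word-injective K {i} {j} h = begin
  i                                 ≡⟨ Fin.funToFin-finToFin {K} {2} i ⟨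
  Fin.funToFin (Fin.finToFun {2} {K} i) ≡⟨ funToFin-cong letters ⟩
  Fin.funToFin (Fin.finToFun {2} {K} j) ≡⟨ Fin.funToFin-finToFin {K} {2} j ⟩
  j                                 ∎
  where
  open ≡-Reasoning
  letters : Fin.finToFun {2} {K} i ≗ Fin.finToFun j
  letters k = Injection.injective (↔⇒↣ Fin.2↔Bool) (h k)

blocks≤bits : ∀ {m W b K} (A : Algorithm m) → Resolves W A b → K ℕ.* b ℕ.≤ W → K ℕ.≤ m
blocks≤bits {m} {b = b} {K} A res fits = ℕ.≮⇒≥ λ m<K →
  let i , j , i<j , e = collision A (ℕ.^-monoʳ-< 2 (s≤s (s≤s z≤n)) m<K) (blocks b ∘ word K)
  in Fin.<⇒≢ i<j (word-injective K (blocks-injective A res (word K i) (word K j) [] fits e))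

-- Combining the two bounds

theorem5 : (W : ℕ) .{{_ : ℕ.NonZero W}}
    (ε : ℝ) (0≤ε : 0ℝ ≤ ε) → ε ≤ fromℚ (+ 1 ℚ./ 4) →
    (m : ℕ) (A : Algorithm m) → Approximates W ε A →
    (k : ℤ) →
    IsFloor k (log₂ W ⊔ (fromℕ 2 * ε + fromℚ (+ 1 ℚ./ W)) ⁻¹⟨ 2x+1/n-positive ε W 0≤ε ⟩) →
    k ℤ.≤ + m
theorem5 W ε 0≤ε ε≤¼ m A approx -[1+ n ] _         = ℤ.-≤+
theorem5 W ε 0≤ε ε≤¼ m A approx (+ n) (n≤max , _) = ℤ.+≤+ (ℕ.≮⇒≥ λ m<n →
  ℕ.1+n≰n (blocks≤bits {W = W} {b} A (resolves {W = W} {ε} {b} A approx (2Wε<b m<n)) K*b≤W))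
  where
  K b : ℕ
  K = suc m
  b = W ℕ./ K
  s⁻¹ : ℝ
  s⁻¹ = (fromℕ 2 * ε + fromℚ (+ 1 ℚ./ W)) ⁻¹⟨ 2x+1/n-positive ε W 0≤ε ⟩
  K*b≤W : K ℕ.* b ℕ.≤ W
  K*b≤W = subst (ℕ._≤ W) (ℕ.*-comm b K) (ℕ.m/n*n≤m W K)
  W<K*[1+b] : W ℕ.< K ℕ.* suc b
  W<K*[1+b] = begin-strict
    W                       ≡⟨ ℕ.m≡m%n+[m/n]*n W K ⟩
    W ℕ.% K ℕ.+ b ℕ.* K     <⟨ ℕ.+-monoˡ-< (b ℕ.* K) (ℕ.m%n<n W K) ⟩
    K ℕ.+ b ℕ.* K           ≡⟨ ℕ.*-comm (suc b) K ⟩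
    K ℕ.* suc b             ∎
    where open ℕ.≤-Reasoning
  log<K : log₂ W < fromℕ K
  log<K = log₂< {W} {K} (window<2^1+m {W = W} A
    (resolves {W = W} {ε} A approx (2Wε<1+⌊W/2⌋ W {ε} ε≤¼)))
  K≤max : m ℕ.< n → fromℕ K ≤ log₂ W ⊔ s⁻¹
  K≤max m<n δ 0<δ = let N , h = n≤max δ 0<δ in
    N , λ i N≤i → ℚ.≤-trans (/1-mono-≤ m<n) (h i N≤i)
  -- As log W < K, it is the reciprocal that is at least K.
  2Wε<b : m ℕ.< n → 2Wε W ε < fromℕ b
  2Wε<b m<n = 2Wε<quotient W {ε} {2x+1/n-positive ε W 0≤ε} {K} {b}
    (≤⊔⇒≤ʳ {log₂ W} {s⁻¹} {fromℕ K} (K≤max m<n) log<K) W<K*[1+b]
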